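{- For every integer $k\geq 1$, the Dobrynin graph $\mathrm{Dob}_k$ (defined below) is interval transmission irregular; more precisely, its $2k+5$ vertices have pairwise distinct transmissions, and the set of these transmissions is $\{3k+4,3k+5,\dots,5k+8\}$.
   Context: All graphs are finite, simple and connected. For a connected graph $G$ and a vertex $u$, the transmission is $Tr_G(u)=\sum_{v\in V(G)} d_G(u,v)$, where $d_G$ is the shortest-path distance. A graph is transmission irregular (TI) if no two of its vertices have equal transmission, and interval transmission irregular (ITI) if it is TI and its set of vertex transmissions equals $[p,q]\cap\mathbb{Z}$ for some integers $p\le q$. The Dobrynin graph $\mathrm{Dob}_k$ ($k\ge1$) has vertex set $\{a,b,c,d\}\cup A\cup B\cup\{ab_1,ab_2\}$ with $A=\{a_0,a_1,\dots,a_{k-1}\}$ and $B=\{b_1,\dots,b_{k-1}\}$ (so $B=\emptyset$ when $k=1$), and edge set: $ab$; $ac$ and $bd$ (so $c,d$ are pendent); $a a_i$ for all $i$; $b b_j$ for all $j$; $a\,ab_1, b\,ab_1, a\,ab_2, b\,ab_2$; $a_i b_j$ for all $1\le j\le i\le k-1$ (so $a_i$ is adjacent to $b_1,\dots,b_i$); $ab_1 a_i$ for all $0\le i\le k-1$; and $ab_2 b_j$ for all $1\le j\le k-1$. There are no other edges. -}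

module Defs where

open import Data.Fin using (Fin; zero; suc; toℕ)
import Data.Fin.Properties as Fin
open import Data.Integer as ℤ using (ℤ; +_)
open import Data.List using (List; []; _∷_; _++_; map; length; allFin)
open import Data.List.Membership.Propositional using (_∈_; find; lose)
open import Data.List.Membership.Propositional.Properties using (∈-map⁺; ∈-map⁻; ∈-++⁺ˡ; ∈-++⁺ʳ; ∈-++⁻; ∈-allFin)
open import Data.List.Relation.Unary.Any using (Any; here; there; any?)
open import Data.List.Relation.Unary.Unique.Propositional using (Unique)
open import Data.List.Relation.Unary.Unique.DecPropositional using (unique?)
open import Data.List.Relation.Unary.Unique.Propositional.Properties using (map⁺; ++⁺; allFin⁺)
open import Data.Nat using (ℕ; zero; suc; _+_; _∸_; _≤_; _<_; s<s⁻¹; _≤?_)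
open import Data.Nat.ListAction using (sum)
open import Data.Product using (∃; ∃₂; _×_; _,_; proj₁)
open import Data.Sum using (_⊎_; inj₁; inj₂)
open import Data.Sum.Properties using (≡-dec)
open import Function using (_∘_)
open import Function.Bundles using (_⇔_)
open import Level using (0ℓ)
open import Relation.Binary.Construct.Closure.Symmetric using (SymClosure; fwd; bwd; symmetric)
open import Relation.Binary.Core using (Rel)
open import Relation.Binary.Definitions using (Decidable; DecidableEquality; Irreflexive; Symmetric)
open import Relation.Binary.PropositionalEquality using (_≡_; refl; sym; trans; cong)
open import Relation.Nullary using (¬_; yes; no)
open import Relation.Nullary.Decidable using (map′; toWitness; _×-dec_; _⊎-dec_)
import Relation.Unary as Unary

IsLeast : (ℕ → Set) → ℕ → Set
IsLeast P n = P n × (∀ m → m < n → ¬ P m)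

least : {P : ℕ → Set} → Unary.Decidable P → ∃ P → ∃ (IsLeast P)
least {P} P? (n , Pn) = go P? n Pn
  where
  go : {Q : ℕ → Set} → Unary.Decidable Q → ∀ n → Q n → ∃ (IsLeast Q)
  go Q? zero    Qn = zero , Qn , λ _ ()
  go Q? (suc n) Qn with Q? zero
  ... | yes Q0 = zero , Q0 , λ _ ()
  ... | no ¬Q0 with go (Q? ∘ suc) n Qn
  ...   | m , Qm , below = suc m , Qm , λ
          { zero    _   → ¬Q0
          ; (suc j) j<m → below j (s<s⁻¹ j<m)
          }

data Walk {V : Set} (_~_ : Rel V 0ℓ) : ℕ → V → V → Set where
  nil  : ∀ {u} → Walk _~_ 0 u u
  cons : ∀ {n u v w} → u ~ v → Walk _~_ n v w → Walk _~_ (suc n) u w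

record ConnectedGraph : Set₁ where
  field
    Vertex    : Set
    _≟_       : DecidableEquality Vertex
    vertices  : List Vertex
    unique    : Unique vertices
    complete  : ∀ v → v ∈ vertices
    _~_       : Rel Vertex 0ℓ
    _~?_      : Decidable _~_
    ~-sym     : Symmetric _~_
    ~-irrefl  : Irreflexive _≡_ _~_
    connected : ∀ u v → ∃ λ n → Walk _~_ n u v

  order : ℕ
  order = length vertices

  walk? : ∀ u v → Unary.Decidable (λ n → Walk _~_ n u v)
  walk? u v zero    = map′ (λ { refl → nil }) (λ { nil → refl }) (u ≟ v)
  walk? u v (suc n) = map′ to from (any? step? vertices)
    where
    Step : Vertex → Set
    Step w = (u ~ w) × Walk _~_ n w v

    step? : Unary.Decidable Step
    step? w = (u ~? w) ×-dec walk? w v n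

    to : Any Step vertices → Walk _~_ (suc n) u v
    to any with find any
    ... | _ , _ , e , p = cons e p

    from : Walk _~_ (suc n) u v → Any Step vertices
    from (cons {v = w} e p) = lose (complete w) (e , p)

  shortest : ∀ u v → ∃ (IsLeast (λ n → Walk _~_ n u v))
  shortest u v = least (walk? u v) (connected u v)

  dist : Vertex → Vertex → ℕ
  dist u v = proj₁ (shortest u v)

  Tr : Vertex → ℕ
  Tr u = sum (map (dist u) vertices)

TransmissionIrregular : ConnectedGraph → Set
TransmissionIrregular G = ∀ u v → Tr u ≡ Tr v → u ≡ v
  where open ConnectedGraph G

IntervalTransmissionIrregular : ConnectedGraph → Set
IntervalTransmissionIrregular G =
  TransmissionIrregular G ×
  (∃₂ λ (p q : ℤ) → p ℤ.≤ q ×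
    (∀ (t : ℤ) → (∃ λ v → + Tr v ≡ t) ⇔ (p ℤ.≤ t × t ℤ.≤ q)))
  where open ConnectedGraph G

-- A is indexed from 0, so aᵢ is  A i.  B is indexed from 1, so bⱼ is
-- B j′ with j = suc (toℕ j′).
data DobVertex (k : ℕ) : Set where
  a b c d ab₁ ab₂ : DobVertex k
  A : Fin k → DobVertex k
  B : Fin (k ∸ 1) → DobVertex k

data DobEdge (k : ℕ) : DobVertex k → DobVertex k → Set where
  a-b   : DobEdge k a b
  a-c   : DobEdge k a c
  b-d   : DobEdge k b d
  a-A   : ∀ i → DobEdge k a (A i)
  b-B   : ∀ j → DobEdge k b (B j)
  a-ab₁ : DobEdge k a ab₁
  b-ab₁ : DobEdge k b ab₁
  a-ab₂ : DobEdge k a ab₂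
  b-ab₂ : DobEdge k b ab₂
  A-B   : ∀ i j → suc (toℕ j) ≤ toℕ i → DobEdge k (A i) (B j)
  ab₁-A : ∀ i → DobEdge k ab₁ (A i)
  ab₂-B : ∀ j → DobEdge k ab₂ (B j)

DobAdj : ∀ k → Rel (DobVertex k) 0ℓ
DobAdj k = SymClosure (DobEdge k)

dobVertices : ∀ k → List (DobVertex k)
dobVertices k = (a ∷ b ∷ c ∷ d ∷ ab₁ ∷ ab₂ ∷ []) ++ map A (allFin k) ++ map B (allFin (k ∸ 1))

module _ {k : ℕ} where

  private
    Code : Set
    Code = Fin 6 ⊎ Fin k ⊎ Fin (k ∸ 1)

    encode : DobVertex k → Code
    encode a     = inj₁ zero
    encode b     = inj₁ (suc zero)
    encode c     = inj₁ (suc (suc zero))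
    encode d     = inj₁ (suc (suc (suc zero)))
    encode ab₁   = inj₁ (suc (suc (suc (suc zero))))
    encode ab₂   = inj₁ (suc (suc (suc (suc (suc zero)))))
    encode (A i) = inj₂ (inj₁ i)
    encode (B j) = inj₂ (inj₂ j)

    decode : Code → DobVertex k
    decode (inj₁ zero)                               = a
    decode (inj₁ (suc zero))                         = b
    decode (inj₁ (suc (suc zero)))                   = c
    decode (inj₁ (suc (suc (suc zero))))             = d
    decode (inj₁ (suc (suc (suc (suc zero)))))       = ab₁
    decode (inj₁ (suc (suc (suc (suc (suc zero)))))) = ab₂
    decode (inj₂ (inj₁ i))                           = A i
    decode (inj₂ (inj₂ j))                           = B j

    decode-encode : ∀ v → decode (encode v) ≡ v
    decode-encode a     = refl
    decode-encode b     = refl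
    decode-encode c     = refl
    decode-encode d     = refl
    decode-encode ab₁   = refl
    decode-encode ab₂   = refl
    decode-encode (A _) = refl
    decode-encode (B _) = refl

  _≟ᵛ_ : DecidableEquality (DobVertex k)
  u ≟ᵛ v = map′
    (λ eq → trans (sym (decode-encode u)) (trans (cong decode eq) (decode-encode v)))
    (cong encode)
    (≡-dec Fin._≟_ (≡-dec Fin._≟_ Fin._≟_) (encode u) (encode v))

  dobEdge? : Decidable (DobEdge k)
  dobEdge? a     a     = no λ ()
  dobEdge? a     b     = yes a-b
  dobEdge? a     c     = yes a-c
  dobEdge? a     d     = no λ ()
  dobEdge? a     ab₁   = yes a-ab₁
  dobEdge? a     ab₂   = yes a-ab₂
  dobEdge? a     (A i) = yes (a-A i)
  dobEdge? a     (B _) = no λ ()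
  dobEdge? b     a     = no λ ()
  dobEdge? b     b     = no λ ()
  dobEdge? b     c     = no λ ()
  dobEdge? b     d     = yes b-d
  dobEdge? b     ab₁   = yes b-ab₁
  dobEdge? b     ab₂   = yes b-ab₂
  dobEdge? b     (A _) = no λ ()
  dobEdge? b     (B j) = yes (b-B j)
  dobEdge? c     _     = no λ ()
  dobEdge? d     _     = no λ ()
  dobEdge? ab₁   a     = no λ ()
  dobEdge? ab₁   b     = no λ ()
  dobEdge? ab₁   c     = no λ ()
  dobEdge? ab₁   d     = no λ ()
  dobEdge? ab₁   ab₁   = no λ ()
  dobEdge? ab₁   ab₂   = no λ ()
  dobEdge? ab₁   (A i) = yes (ab₁-A i)
  dobEdge? ab₁   (B _) = no λ ()
  dobEdge? ab₂   a     = no λ ()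
  dobEdge? ab₂   b     = no λ ()
  dobEdge? ab₂   c     = no λ ()
  dobEdge? ab₂   d     = no λ ()
  dobEdge? ab₂   ab₁   = no λ ()
  dobEdge? ab₂   ab₂   = no λ ()
  dobEdge? ab₂   (A _) = no λ ()
  dobEdge? ab₂   (B j) = yes (ab₂-B j)
  dobEdge? (A _) a     = no λ ()
  dobEdge? (A _) b     = no λ ()
  dobEdge? (A _) c     = no λ ()
  dobEdge? (A _) d     = no λ ()
  dobEdge? (A _) ab₁   = no λ ()
  dobEdge? (A _) ab₂   = no λ ()
  dobEdge? (A _) (A _) = no λ ()
  dobEdge? (A i) (B j) = map′ (A-B i j) (λ { (A-B _ _ j≤i) → j≤i }) (suc (toℕ j) ≤? toℕ i)
  dobEdge? (B _) _     = no λ ()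

  dobAdj? : Decidable (DobAdj k)
  dobAdj? u v = map′
    (λ { (inj₁ e) → fwd e ; (inj₂ e) → bwd e })
    (λ { (fwd e) → inj₁ e ; (bwd e) → inj₂ e })
    (dobEdge? u v ⊎-dec dobEdge? v u)

  dobAdj-irrefl : Irreflexive _≡_ (DobAdj k)
  dobAdj-irrefl refl (fwd ())
  dobAdj-irrefl refl (bwd ())

  dobUnique : Unique (dobVertices k)
  dobUnique = ++⁺
    (toWitness {a? = unique? _≟ᵛ_ (a ∷ b ∷ c ∷ d ∷ ab₁ ∷ ab₂ ∷ [])} _)
    (++⁺ (map⁺ (λ { refl → refl }) (allFin⁺ k)) (map⁺ (λ { refl → refl }) (allFin⁺ (k ∸ 1))) A#B)
    six#rest
    where
    A#B : ∀ {v : DobVertex k} → ¬ (v ∈ map A (allFin k) × v ∈ map B (allFin (k ∸ 1)))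
    A#B (p , q) with ∈-map⁻ A p | ∈-map⁻ B q
    ... | _ , _ , refl | _ , _ , ()

    six≢A : ∀ {i : Fin k} → ¬ (A i ∈ (a ∷ b ∷ c ∷ d ∷ ab₁ ∷ ab₂ ∷ []))
    six≢A (there (there (there (there (there (there ()))))))

    six≢B : ∀ {j : Fin (k ∸ 1)} → ¬ (B {k} j ∈ (a ∷ b ∷ c ∷ d ∷ ab₁ ∷ ab₂ ∷ []))
    six≢B (there (there (there (there (there (there ()))))))

    six#rest : ∀ {v : DobVertex k} → ¬ (v ∈ (a ∷ b ∷ c ∷ d ∷ ab₁ ∷ ab₂ ∷ []) ×
                                        v ∈ map A (allFin k) ++ map B (allFin (k ∸ 1)))
    six#rest (p , q) with ∈-++⁻ (map A (allFin k)) q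
    ... | inj₁ r with ∈-map⁻ A r
    ...   | _ , _ , refl = six≢A p
    six#rest (p , q) | inj₂ r with ∈-map⁻ B r
    ...   | _ , _ , refl = six≢B p

  dobComplete : ∀ v → v ∈ dobVertices k
  dobComplete a     = here refl
  dobComplete b     = there (here refl)
  dobComplete c     = there (there (here refl))
  dobComplete d     = there (there (there (here refl)))
  dobComplete ab₁   = there (there (there (there (here refl))))
  dobComplete ab₂   = there (there (there (there (there (here refl)))))
  dobComplete (A i) = ∈-++⁺ʳ (a ∷ b ∷ c ∷ d ∷ ab₁ ∷ ab₂ ∷ []) (∈-++⁺ˡ (∈-map⁺ A (∈-allFin i)))
  dobComplete (B j) = ∈-++⁺ʳ (a ∷ b ∷ c ∷ d ∷ ab₁ ∷ ab₂ ∷ []) (∈-++⁺ʳ (map A (allFin k)) (∈-map⁺ B (∈-allFin j)))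

  private
    toHub : ∀ u → ∃ λ n → Walk (DobAdj k) n u a
    toHub a     = _ , nil
    toHub b     = _ , cons (bwd a-b) nil
    toHub c     = _ , cons (bwd a-c) nil
    toHub d     = _ , cons (bwd b-d) (cons (bwd a-b) nil)
    toHub ab₁   = _ , cons (bwd a-ab₁) nil
    toHub ab₂   = _ , cons (bwd a-ab₂) nil
    toHub (A i) = _ , cons (bwd (a-A i)) nil
    toHub (B j) = _ , cons (bwd (b-B j)) (cons (bwd a-b) nil)

    fromHub : ∀ v → ∃ λ n → Walk (DobAdj k) n a v
    fromHub a     = _ , nil
    fromHub b     = _ , cons (fwd a-b) nil
    fromHub c     = _ , cons (fwd a-c) nil
    fromHub d     = _ , cons (fwd a-b) (cons (fwd b-d) nil)
    fromHub ab₁   = _ , cons (fwd a-ab₁) nil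
    fromHub ab₂   = _ , cons (fwd a-ab₂) nil
    fromHub (A i) = _ , cons (fwd (a-A i)) nil
    fromHub (B j) = _ , cons (fwd a-b) (cons (fwd (b-B j)) nil)

    _▷_ : ∀ {m n u v w} → Walk (DobAdj k) m u v → Walk (DobAdj k) n v w → Walk (DobAdj k) (m + n) u w
    nil      ▷ q = q
    cons e p ▷ q = cons e (p ▷ q)

  dobConnected : ∀ u v → ∃ λ n → Walk (DobAdj k) n u v
  dobConnected u v with toHub u | fromHub v
  ... | _ , p | _ , q = _ , p ▷ q

-- Only k ≥ 1 is meaningful; at k = 0 both A and B are empty.
Dob : ℕ → ConnectedGraph
Dob k = record
  { Vertex    = DobVertex k
  ; _≟_       = _≟ᵛ_
  ; vertices  = dobVertices k
  ; unique    = dobUnique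
  ; complete  = dobComplete
  ; _~_       = DobAdj k
  ; _~?_      = dobAdj?
  ; ~-sym     = symmetric (DobEdge k)
  ; ~-irrefl  = dobAdj-irrefl
  ; connected = dobConnected
  }

{-# OPTIONS --safe #-}

-- Write m = k − 1.  The graph has diameter 3, and two vertices are at distance 3
-- exactly when they are c,d or c,bⱼ or d,aᵢ or nonadjacent aᵢ,bⱼ.  Summing the
-- distances gives, relative to the smallest value 3k + 4, the transmissions
--   a, ab₁, aₘ, …, a₀, d   ↦  0, 2, 4, …, 2m + 4, 2m + 6
--   b, ab₂, b₁, …, bₘ, c   ↦  1, 3, 5, …, 2m + 3, 2m + 5
-- which enumerate 0, …, 2m + 6 without repetition.
module Submission where

open import Defs
open import Data.Fin using (Fin; zero; suc; toℕ; fromℕ<; opposite)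
import Data.Fin.Properties as Fin
open import Data.Integer as ℤ using (+≤+)
open import Data.List using (List; _++_; map; tabulate; allFin; length)
open import Data.List.Properties using (map-∘; map-tabulate; map-++; length-++; length-map; length-tabulate)
open import Data.Nat using (ℕ; zero; suc; _+_; _*_; _≤_; _<_; z≤n; s≤s; s≤s⁻¹; _<?_)
open import Data.Nat.ListAction using (sum)
open import Data.Nat.ListAction.Properties using (sum-++)
open import Data.Nat.Properties using (<-cmp; suc-injective; +-assoc; +-suc; *-suc; m+[n∸m]≡n; m≤m+n; n≤1+n; ≤-refl; ≤-reflexive; ≤-trans; ≤-antisym; <⇒≤; <⇒≱; ≮⇒≥; +-mono-≤; +-monoʳ-≤; *-monoʳ-≤; +-cancelˡ-≡; +-cancelˡ-≤; *-cancelˡ-≤; *-cancelˡ-<; m≤n⇒∃[o]m+o≡n)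
open import Data.Nat.Tactic.RingSolver using (solve-∀)
open import Data.Product using (∃; _×_; _,_; proj₂)
open import Data.Sum using (_⊎_; inj₁; inj₂)
open import Function using (_∘_; id)
open import Function.Bundles using (_⇔_; mk⇔; Equivalence)
open import Relation.Binary.Construct.Closure.Symmetric using (fwd; bwd)
open import Relation.Binary.Definitions using (tri<; tri≈; tri>)
open import Relation.Binary.PropositionalEquality using (_≡_; _≢_; refl; sym; trans; cong; cong₂; subst; module ≡-Reasoning)
open import Relation.Nullary using (¬_; yes; no; contradiction)
open import Relation.Nullary.Decidable using (True; False; toWitness; toWitnessFalse)
open ConnectedGraph using (order; Tr)

-- Certifying distances by walks.

IsLeast-unique : ∀ {P : ℕ → Set} {m n} → IsLeast P m → IsLeast P n → m ≡ n
IsLeast-unique {m = m} {n} (Pm , ¬P<m) (Pn , ¬P<n) with <-cmp m n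
... | tri< m<n _ _ = contradiction Pm (¬P<n m m<n)
... | tri≈ _ m≡n _ = m≡n
... | tri> _ _ n<m = contradiction Pn (¬P<m n n<m)

module Distance (G : ConnectedGraph) where
  open ConnectedGraph G hiding (Tr; order)

  IsDist : Vertex → Vertex → ℕ → Set
  IsDist u v n = IsLeast (λ l → Walk _~_ l u v) n

  -- `dist` is the output of a search that does not evaluate for symbolic `k`. Uniqueness of a least
  -- length lets a hand-made certificate `IsDist` replace it.
  dist-unique : ∀ {u v n} → IsDist u v n → dist u v ≡ n
  dist-unique {u} {v} = IsLeast-unique (proj₂ (shortest u v))

  isDist-0 : ∀ {u} → IsDist u u 0
  isDist-0 = nil , λ _ ()

  isDist-1 : ∀ {u v} → u ~ v → IsDist u v 1
  isDist-1 e = cons e nil , λ { zero _ nil → ~-irrefl refl e ; (suc _) (s≤s ()) }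

  isDist-2 : ∀ {u v w} → u ≢ v → ¬ u ~ v → u ~ w → w ~ v → IsDist u v 2
  isDist-2 u≢v u≁v e f = cons e (cons f nil) , λ
    { zero          _ nil          → u≢v refl
    ; (suc zero)    _ (cons g nil) → u≁v g
    ; (suc (suc _)) (s≤s (s≤s ()))
    }

  -- Lengths 0 and 1 are excluded by testing equality and adjacency of `u` and `v`. Length 2
  -- involves a third vertex, so its absence is a separate hypothesis.
  isDist-3 : ∀ {u v w x} → u ≢ v → ¬ u ~ v → ¬ Walk _~_ 2 u v →
             u ~ w → w ~ x → x ~ v → IsDist u v 3
  isDist-3 u≢v u≁v ¬walk₂ e f g = cons e (cons f (cons g nil)) , λ
    { zero                _ nil          → u≢v refl
    ; (suc zero)          _ (cons h nil) → u≁v h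
    ; (suc (suc zero))    _ p            → ¬walk₂ p
    ; (suc (suc (suc _))) (s≤s (s≤s (s≤s ())))
    }

  -- The tests compute once the vertex constructors are known, so the implicit proofs in `edge`,
  -- `via` and `via₂` fill themselves in. Pairs whose test depends on an index, such as `A i` and
  -- `B j`, use the explicit lemmas instead.
  edge : ∀ {u v} {u~v : True (u ~? v)} → IsDist u v 1
  edge {u~v = u~v} = isDist-1 (toWitness u~v)

  via : ∀ {u v} w {u≢v : False (u ≟ v)} {u≁v : False (u ~? v)}
        {u~w : True (u ~? w)} {w~v : True (w ~? v)} → IsDist u v 2
  via w {u≢v} {u≁v} {u~w} {w~v} =
    isDist-2 (toWitnessFalse u≢v) (toWitnessFalse u≁v) (toWitness u~w) (toWitness w~v)

  via₂ : ∀ {u v} w x → ¬ Walk _~_ 2 u v → {u≢v : False (u ≟ v)} {u≁v : False (u ~? v)}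
         {u~w : True (u ~? w)} {w~x : True (w ~? x)} {x~v : True (x ~? v)} → IsDist u v 3
  via₂ w x ¬walk₂ {u≢v} {u≁v} {u~w} {w~x} {x~v} =
    isDist-3 (toWitnessFalse u≢v) (toWitnessFalse u≁v) ¬walk₂
             (toWitness u~w) (toWitness w~x) (toWitness x~v)

-- Sums of step functions and of punctured constants.

sum-step : ∀ {n x y} t s → n ≡ t + s → (f : Fin n → ℕ) →
           (∀ i → toℕ i < t → f i ≡ x) → (∀ i → t ≤ toℕ i → f i ≡ y) →
           sum (tabulate f) ≡ t * x + s * y
sum-step {zero}  zero    zero    _  f _  _  = refl
sum-step {suc n} {x} zero    (suc s) eq f lo hi =
  cong₂ _+_ (hi zero z≤n) (sum-step {x = x} zero s (suc-injective eq) (f ∘ suc) (λ _ ()) λ i _ → hi (suc i) z≤n)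
sum-step {suc n} {x} {y} (suc t) s eq f lo hi = trans
  (cong₂ _+_ (lo zero (s≤s z≤n))
    (sum-step t s (suc-injective eq) (f ∘ suc) (λ i → lo (suc i) ∘ s≤s) (λ i → hi (suc i) ∘ s≤s)))
  (sym (+-assoc x (t * x) (s * y)))

sum-const : ∀ {n x} (f : Fin n → ℕ) → (∀ i → f i ≡ x) → sum (tabulate f) ≡ n * x
sum-const {n} {x} f eq = sum-step {x = x} 0 n refl f (λ _ ()) λ i _ → eq i

-- Meant for the distances from a vertex to its own family. The size enters by an equation because
-- for `B j` it is the variable `m`, seen to be positive only through `j`.
sum-except : ∀ {n n′ x} → n ≡ suc n′ → (f : Fin n → ℕ) (i : Fin n) →
             f i ≡ 0 → (∀ j → i ≢ j → f j ≡ x) → sum (tabulate f) ≡ n′ * x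
sum-except refl f zero fi≡0 eq =
  cong₂ _+_ fi≡0 (sum-const (f ∘ suc) (λ j → eq (suc j) λ ()))
sum-except {n′ = suc _} refl f (suc i) fi≡0 eq =
  cong₂ _+_ (eq zero λ ())
    (sum-except refl (f ∘ suc) i fi≡0 λ j i≢j → eq (suc j) (i≢j ∘ Fin.suc-injective))

-- `opposite i` counts the indices above `i`; for `A i` this is the number of vertices `B j` at
-- distance 3.
toℕ+opposite : ∀ {n} (i : Fin (suc n)) → n ≡ toℕ i + toℕ (opposite i)
toℕ+opposite i = trans (sym (m+[n∸m]≡n (Fin.toℕ≤pred[n] i))) (cong (toℕ i +_) (sym (Fin.opposite-prop i)))

suc-toℕ+opposite : ∀ {n} (i : Fin n) → n ≡ suc (toℕ i + toℕ (opposite i))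
suc-toℕ+opposite {suc n} i = cong suc (toℕ+opposite i)

-- Distances and transmissions in the Dobrynin graph.

module _ {m : ℕ} where

  private
    k : ℕ
    k = suc m

    V : Set
    V = DobVertex k

  open ConnectedGraph (Dob k) using (dist)
  open Distance (Dob k)

  ¬walk₂-c-d : ¬ Walk (DobAdj k) 2 c d
  ¬walk₂-c-d (cons (bwd a-c) (cons (fwd ()) nil))
  ¬walk₂-c-d (cons (bwd a-c) (cons (bwd ()) nil))

  ¬walk₂-d-c : ¬ Walk (DobAdj k) 2 d c
  ¬walk₂-d-c (cons (bwd b-d) (cons (fwd ()) nil))
  ¬walk₂-d-c (cons (bwd b-d) (cons (bwd ()) nil))

  ¬walk₂-c-B : ∀ {j} → ¬ Walk (DobAdj k) 2 c (B j)
  ¬walk₂-c-B (cons (bwd a-c) (cons (fwd ()) nil))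
  ¬walk₂-c-B (cons (bwd a-c) (cons (bwd ()) nil))

  ¬walk₂-B-c : ∀ {j} → ¬ Walk (DobAdj k) 2 (B j) c
  ¬walk₂-B-c (cons (bwd (b-B _)) (cons (fwd ()) nil))
  ¬walk₂-B-c (cons (bwd (A-B _ _ _)) (cons (fwd ()) nil))
  ¬walk₂-B-c (cons (bwd (ab₂-B _)) (cons (fwd ()) nil))
  ¬walk₂-B-c (cons _ (cons (bwd ()) nil))

  ¬walk₂-d-A : ∀ {i} → ¬ Walk (DobAdj k) 2 d (A i)
  ¬walk₂-d-A (cons (bwd b-d) (cons (fwd ()) nil))
  ¬walk₂-d-A (cons (bwd b-d) (cons (bwd ()) nil))

  ¬walk₂-A-d : ∀ {i} → ¬ Walk (DobAdj k) 2 (A i) d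
  ¬walk₂-A-d (cons (fwd (A-B _ _ _)) (cons (fwd ()) nil))
  ¬walk₂-A-d (cons (bwd (a-A _)) (cons (fwd ()) nil))
  ¬walk₂-A-d (cons (bwd (ab₁-A _)) (cons (fwd ()) nil))
  ¬walk₂-A-d (cons _ (cons (bwd ()) nil))

  -- The neighbours of `A i` lie among `a`, `ab₁` and the `B` vertices, those of `B j` among `b`,
  -- `ab₂` and the `A` vertices. These sets are disjoint, so there is no common neighbour.
  ¬walk₂-A-B : ∀ {i j} → ¬ Walk (DobAdj k) 2 (A i) (B j)
  ¬walk₂-A-B (cons (fwd (A-B _ _ _)) (cons (fwd ()) nil))
  ¬walk₂-A-B (cons (bwd (a-A _)) (cons (fwd ()) nil))
  ¬walk₂-A-B (cons (bwd (ab₁-A _)) (cons (fwd ()) nil))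
  ¬walk₂-A-B (cons _ (cons (bwd ()) nil))

  ¬walk₂-B-A : ∀ {i j} → ¬ Walk (DobAdj k) 2 (B j) (A i)
  ¬walk₂-B-A (cons (bwd (b-B _)) (cons (fwd ()) nil))
  ¬walk₂-B-A (cons (bwd (A-B _ _ _)) (cons (fwd ()) nil))
  ¬walk₂-B-A (cons (bwd (ab₂-B _)) (cons (fwd ()) nil))
  -- Directed edges do leave `A i`, towards `B`, so a reversed last edge is refuted only once the
  -- middle vertex is known.
  ¬walk₂-B-A (cons (bwd (b-B _)) (cons (bwd ()) nil))
  ¬walk₂-B-A (cons (bwd (A-B _ _ _)) (cons (bwd ()) nil))
  ¬walk₂-B-A (cons (bwd (ab₂-B _)) (cons (bwd ()) nil))

  A-A-dist : ∀ {i i′} → i ≢ i′ → IsDist (A i) (A i′) 2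
  A-A-dist {i} {i′} i≢i′ =
    isDist-2 (λ { refl → i≢i′ refl }) (λ { (fwd ()) ; (bwd ()) }) (bwd (a-A i)) (fwd (a-A i′))

  B-B-dist : ∀ {j j′} → j ≢ j′ → IsDist (B j) (B j′) 2
  B-B-dist {j} {j′} j≢j′ =
    isDist-2 (λ { refl → j≢j′ refl }) (λ { (fwd ()) ; (bwd ()) }) (bwd (b-B j)) (fwd (b-B j′))

  -- The near and far hypotheses are shaped as the two cases of `sum-step`: the threshold is `toℕ i`
  -- when the index in `B` varies, and `suc (toℕ j)` when the index in `A` varies.
  A-B-near : ∀ {i j} → toℕ j < toℕ i → IsDist (A i) (B j) 1
  A-B-near j<i = isDist-1 (fwd (A-B _ _ j<i))

  A-B-far : ∀ {i j} → toℕ i ≤ toℕ j → IsDist (A i) (B j) 3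
  A-B-far {i} {j} i≤j = isDist-3 (λ ())
    (λ { (fwd (A-B _ _ j<i)) → <⇒≱ j<i i≤j ; (bwd ()) }) ¬walk₂-A-B
    (bwd (a-A i)) (fwd a-b) (fwd (b-B j))

  B-A-near : ∀ {i j} → suc (toℕ j) ≤ toℕ i → IsDist (B j) (A i) 1
  B-A-near j<i = isDist-1 (bwd (A-B _ _ j<i))

  B-A-far : ∀ {i j} → toℕ i < suc (toℕ j) → IsDist (B j) (A i) 3
  B-A-far {i} {j} i≤j = isDist-3 (λ ())
    (λ { (bwd (A-B _ _ j<i)) → <⇒≱ i≤j j<i ; (fwd ()) }) ¬walk₂-B-A
    (bwd (b-B j)) (bwd a-b) (fwd (a-A i))

  ΣA ΣB : V → ℕ
  ΣA u = sum (tabulate λ i → dist u (A i))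
  ΣB u = sum (tabulate λ j → dist u (B j))

  -- The nesting follows `sum` over `dobVertices`. With numerals for the six single distances it
  -- evaluates to a constant plus `y + z`, the form in which each `arith` below is stated.
  Tr-split : ∀ {u x₁ x₂ x₃ x₄ x₅ x₆ y z} →
             IsDist u a x₁ → IsDist u b x₂ → IsDist u c x₃ → IsDist u d x₄ →
             IsDist u ab₁ x₅ → IsDist u ab₂ x₆ → ΣA u ≡ y → ΣB u ≡ z →
             Tr (Dob k) u ≡ x₁ + (x₂ + (x₃ + (x₄ + (x₅ + (x₆ + (y + z))))))
  Tr-split {u} {y = y} {z} p₁ p₂ p₃ p₄ p₅ p₆ q r =
    dist-unique p₁ ⊕ dist-unique p₂ ⊕ dist-unique p₃ ⊕ dist-unique p₄ ⊕
    dist-unique p₅ ⊕ dist-unique p₆ ⊕ rest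
    where
    infixr 6 _⊕_
    _⊕_ : ∀ {p q r s : ℕ} → p ≡ q → r ≡ s → p + r ≡ q + s
    _⊕_ = cong₂ _+_

    sum-family : ∀ {n} (g : Fin n → V) →
                 sum (map (dist u) (map g (allFin n))) ≡ sum (tabulate (dist u ∘ g))
    sum-family {n} g = cong sum (trans (sym (map-∘ (allFin n))) (map-tabulate id (dist u ∘ g)))

    rest : sum (map (dist u) (map A (allFin k) ++ map B (allFin m))) ≡ y + z
    rest = trans (cong sum (map-++ (dist u) (map A (allFin k)) _))
          (trans (sum-++ (map (dist u) (map A (allFin k))) _)
                 (trans (sum-family A) q ⊕ trans (sum-family B) r))

  ΣA-const : ∀ u {x} → (∀ i → IsDist u (A i) x) → ΣA u ≡ k * x
  ΣA-const _ p = sum-const _ (dist-unique ∘ p)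

  ΣB-const : ∀ u {x} → (∀ j → IsDist u (B j) x) → ΣB u ≡ m * x
  ΣB-const _ p = sum-const _ (dist-unique ∘ p)

  -- `opposite` enters because a larger `i` gives `A i` more neighbours in `B`, hence a smaller
  -- transmission.
  rank : V → ℕ
  rank a     = 0
  rank b     = 1
  rank ab₁   = 2
  rank ab₂   = 3
  rank (A i) = 4 + 2 * toℕ (opposite i)
  rank (B j) = 5 + 2 * toℕ j
  rank c     = 5 + 2 * m
  rank d     = 6 + 2 * m

  Tr-rank : ∀ v → Tr (Dob k) v ≡ (3 * k + 4) + rank v
  Tr-rank a = trans
    (Tr-split isDist-0 edge edge (via b) edge edge
      (ΣA-const a λ _ → edge) (ΣB-const a λ _ → via b))
    (arith m)
    where
    arith : ∀ m → 6 + (suc m * 1 + m * 2) ≡ (3 * suc m + 4) + 0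
    arith = solve-∀
  Tr-rank b = trans
    (Tr-split edge isDist-0 (via a) edge edge edge
      (ΣA-const b λ _ → via a) (ΣB-const b λ _ → edge))
    (arith m)
    where
    arith : ∀ m → 6 + (suc m * 2 + m * 1) ≡ (3 * suc m + 4) + 1
    arith = solve-∀
  Tr-rank c = trans
    (Tr-split edge (via a) isDist-0 (via₂ a b ¬walk₂-c-d) (via a) (via a)
      (ΣA-const c λ _ → via a) (ΣB-const c λ _ → via₂ a b ¬walk₂-c-B))
    (arith m)
    where
    arith : ∀ m → 10 + (suc m * 2 + m * 3) ≡ (3 * suc m + 4) + (5 + 2 * m)
    arith = solve-∀
  Tr-rank d = trans
    (Tr-split (via b) edge (via₂ b a ¬walk₂-d-c) isDist-0 (via b) (via b)
      (ΣA-const d λ _ → via₂ b a ¬walk₂-d-A) (ΣB-const d λ _ → via b))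
    (arith m)
    where
    arith : ∀ m → 10 + (suc m * 3 + m * 2) ≡ (3 * suc m + 4) + (6 + 2 * m)
    arith = solve-∀
  Tr-rank ab₁ = trans
    (Tr-split edge edge (via a) (via b) isDist-0 (via a)
      (ΣA-const ab₁ λ _ → edge) (ΣB-const ab₁ λ _ → via b))
    (arith m)
    where
    arith : ∀ m → 8 + (suc m * 1 + m * 2) ≡ (3 * suc m + 4) + 2
    arith = solve-∀
  Tr-rank ab₂ = trans
    (Tr-split edge edge (via a) (via b) (via a) isDist-0
      (ΣA-const ab₂ λ _ → via a) (ΣB-const ab₂ λ _ → edge))
    (arith m)
    where
    arith : ∀ m → 8 + (suc m * 2 + m * 1) ≡ (3 * suc m + 4) + 3
    arith = solve-∀
  Tr-rank (A i) = trans
    (Tr-split edge (via a) (via a) (via₂ a b ¬walk₂-A-d) edge (via a)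
      (sum-except refl _ i (dist-unique (isDist-0 {A i})) λ _ → dist-unique ∘ A-A-dist)
      (sum-step (toℕ i) (toℕ (opposite i)) (toℕ+opposite i) _
        (λ _ → dist-unique ∘ A-B-near) (λ _ → dist-unique ∘ A-B-far)))
    (arith (toℕ i) (toℕ (opposite i)) (toℕ+opposite i))
    where
    identity : ∀ t s → 11 + ((t + s) * 2 + (t * 1 + s * 3)) ≡ (3 * suc (t + s) + 4) + (4 + 2 * s)
    identity = solve-∀

    -- With the sizes generalised to variables, `refl` can replace `m` by `t + s`, leaving a
    -- polynomial identity for the solver.
    arith : ∀ {m} t s → m ≡ t + s →
            11 + (m * 2 + (t * 1 + s * 3)) ≡ (3 * suc m + 4) + (4 + 2 * s)
    arith t s refl = identity t s
  Tr-rank (B j) = trans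
    (Tr-split (via b) edge (via₂ b a ¬walk₂-B-c) (via b) (via b) edge
      -- Since `B` is indexed from 1, `B j` is at distance 3 from `A i` for the `suc (toℕ j)`
      -- indices up to `toℕ j`, and adjacent to the other `suc (toℕ (opposite j))`.
      (sum-step (suc (toℕ j)) (suc (toℕ (opposite j)))
        (trans (cong suc (suc-toℕ+opposite j)) (cong suc (sym (+-suc _ _)))) _
        (λ _ → dist-unique ∘ B-A-far) (λ _ → dist-unique ∘ B-A-near))
      (sum-except (suc-toℕ+opposite j) _ j (dist-unique (isDist-0 {B j})) λ _ → dist-unique ∘ B-B-dist))
    (arith (toℕ j) (toℕ (opposite j)) (suc-toℕ+opposite j))
    where
    identity : ∀ t s → 11 + ((suc t * 3 + suc s * 1) + (t + s) * 2) ≡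
                       (3 * suc (suc (t + s)) + 4) + (5 + 2 * t)
    identity = solve-∀

    arith : ∀ {m} t s → m ≡ suc (t + s) →
            11 + ((suc t * 3 + suc s * 1) + (t + s) * 2) ≡ (3 * suc m + 4) + (5 + 2 * t)
    arith t s refl = identity t s

-- Interleaving two extended finite sequences.

extend : ∀ {n} {X : Set} → (Fin n → X) → X → ℕ → X
extend {zero}  f x _       = x
extend {suc n} f x zero    = f zero
extend {suc n} f x (suc q) = extend (f ∘ suc) x q

extend-toℕ : ∀ {n} {X : Set} (f : Fin n → X) x i → extend f x (toℕ i) ≡ f i
extend-toℕ f x zero    = refl
extend-toℕ f x (suc i) = extend-toℕ (f ∘ suc) x i

-- The pendent vertices sit one past the end of a family: the rank of `d` continues the pattern of
-- `A`, and that of `c` the pattern of `B`.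
extend-end : ∀ {n} {X : Set} (f : Fin n → X) x → extend f x n ≡ x
extend-end {zero}  f x = refl
extend-end {suc n} f x = extend-end (f ∘ suc) x

interleave : {X : Set} → (ℕ → X) → (ℕ → X) → ℕ → X
interleave f g zero    = f zero
interleave f g (suc r) = interleave g (f ∘ suc) r

interleave-even : ∀ {X : Set} (f g : ℕ → X) q → interleave f g (2 * q) ≡ f q
interleave-even f g zero = refl
-- The second successor in `2 * suc q` is buried in the sum and must surface before `interleave` can
-- take two steps.
interleave-even f g (suc q) rewrite +-suc q (q + 0) = interleave-even (f ∘ suc) (g ∘ suc) q

-- Dropping the first term swaps the two sequences, so odd places become even places.
interleave-odd : ∀ {X : Set} (f g : ℕ → X) q → interleave f g (1 + 2 * q) ≡ g q
interleave-odd f g = interleave-even g (f ∘ suc)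

even⊎odd : ∀ r → ∃ λ q → r ≡ 2 * q ⊎ r ≡ 1 + 2 * q
even⊎odd zero = 0 , inj₁ refl
even⊎odd (suc r) with even⊎odd r
... | q , inj₁ refl = q , inj₂ refl
... | q , inj₂ refl = suc q , inj₁ (cong suc (sym (+-suc q (q + 0))))

-- Enumerating the vertices by rank.

module _ {m : ℕ} where

  private
    k : ℕ
    k = suc m

    V : Set
    V = DobVertex k

    evens odds : ℕ → V
    evens = extend (A ∘ opposite) d
    odds  = extend B c

  unrank : ℕ → V
  unrank 0 = a
  unrank 1 = b
  unrank 2 = ab₁
  unrank 3 = ab₂
  unrank (suc (suc (suc (suc r)))) = interleave evens odds r

  -- A left inverse yields injectivity of `rank` without comparing the constructors in pairs.
  unrank-rank : ∀ v → unrank (rank v) ≡ v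
  unrank-rank a     = refl
  unrank-rank b     = refl
  unrank-rank ab₁   = refl
  unrank-rank ab₂   = refl
  unrank-rank (A i) = trans (interleave-even evens odds (toℕ (opposite i)))
    (trans (extend-toℕ (A ∘ opposite) d (opposite i)) (cong A (Fin.opposite-involutive i)))
  unrank-rank (B j) = trans (interleave-odd evens odds (toℕ j)) (extend-toℕ B c j)
  unrank-rank c     = trans (interleave-odd evens odds m) (extend-end B c)
  -- After removing 4, the rank of `d` leaves `2 + 2 * m`, that is `2 * k`: place `k` of `evens`,
  -- just past the `A` vertices.
  unrank-rank d     = trans (cong (interleave evens odds) (sym (*-suc 2 m)))
    (trans (interleave-even evens odds k) (extend-end {k} (A ∘ opposite) d))

  rank-injective : ∀ {u v : V} → rank u ≡ rank v → u ≡ v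
  rank-injective {u} {v} eq = trans (sym (unrank-rank u)) (trans (cong unrank eq) (unrank-rank v))

  rank-bound : ∀ (v : V) → rank v ≤ 6 + 2 * m
  rank-bound a     = z≤n
  rank-bound b     = s≤s z≤n
  rank-bound ab₁   = s≤s (s≤s z≤n)
  rank-bound ab₂   = s≤s (s≤s (s≤s z≤n))
  rank-bound (A i) = +-mono-≤ (m≤m+n 4 2) (*-monoʳ-≤ 2 (Fin.toℕ≤pred[n] (opposite i)))
  rank-bound (B j) = +-mono-≤ (m≤m+n 5 1) (*-monoʳ-≤ 2 (<⇒≤ (Fin.toℕ<n j)))
  rank-bound c     = n≤1+n _
  rank-bound d     = ≤-refl

  rank-surjective : ∀ r → r ≤ 6 + 2 * m → ∃ λ (v : V) → rank v ≡ r
  rank-surjective 0 _ = a , refl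
  rank-surjective 1 _ = b , refl
  rank-surjective 2 _ = ab₁ , refl
  rank-surjective 3 _ = ab₂ , refl
  rank-surjective (suc (suc (suc (suc r)))) (s≤s (s≤s (s≤s (s≤s r≤)))) with even⊎odd r
  ... | q , inj₁ refl with q <? k
  ...   | yes q<k = A (opposite (fromℕ< q<k)) ,
          cong (λ x → 4 + 2 * x) (trans (cong toℕ (Fin.opposite-involutive _)) (Fin.toℕ-fromℕ< q<k))
  -- The bound `2 * q ≤ 2 + 2 * m` gives `q ≤ k`, so `q` equals `k`.
  ...   | no  q≮k = d , trans (cong (4 +_) (sym (*-suc 2 m))) (cong (λ x → 4 + 2 * x) (≤-antisym (≮⇒≥ q≮k)
          (*-cancelˡ-≤ 2 (≤-trans r≤ (≤-reflexive (sym (*-suc 2 m)))))))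
  rank-surjective (suc (suc (suc (suc r)))) (s≤s (s≤s (s≤s (s≤s r≤)))) | q , inj₂ refl with q <? m
  ...   | yes q<m = B (fromℕ< q<m) , cong (λ x → 5 + 2 * x) (Fin.toℕ-fromℕ< q<m)
  -- The bound `1 + 2 * q ≤ 2 + 2 * m` reads `2 * q < 2 * suc m`, hence `q ≤ m` and `q` equals `m`.
  ...   | no  q≮m = c , cong (λ x → 5 + 2 * x) (≤-antisym (≮⇒≥ q≮m)
          (s≤s⁻¹ (*-cancelˡ-< 2 q (suc m) (≤-trans r≤ (≤-reflexive (sym (*-suc 2 m)))))))

  -- From ranks to the interval of transmissions.

  Dob-TI : TransmissionIrregular (Dob k)
  Dob-TI u v eq = rank-injective (+-cancelˡ-≡ (3 * k + 4) _ _
    (trans (sym (Tr-rank u)) (trans eq (Tr-rank v))))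

  max-rank : (3 * k + 4) + (6 + 2 * m) ≡ 5 * k + 8
  max-rank = identity m
    where
    identity : ∀ m → (3 * suc m + 4) + (6 + 2 * m) ≡ 5 * suc m + 8
    identity = solve-∀

  Tr-range : ∀ t → (∃ λ v → Tr (Dob k) v ≡ t) ⇔ (3 * k + 4 ≤ t × t ≤ 5 * k + 8)
  Tr-range t = mk⇔ to from
    where
    to : (∃ λ v → Tr (Dob k) v ≡ t) → 3 * k + 4 ≤ t × t ≤ 5 * k + 8
    to (v , eq) = subst (λ x → 3 * k + 4 ≤ x × x ≤ 5 * k + 8) (trans (sym (Tr-rank v)) eq)
      ( m≤m+n (3 * k + 4) (rank v)
      , ≤-trans (+-monoʳ-≤ (3 * k + 4) (rank-bound v)) (≤-reflexive max-rank))

    from : 3 * k + 4 ≤ t × t ≤ 5 * k + 8 → ∃ λ v → Tr (Dob k) v ≡ t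
    from (lo , hi) with m≤n⇒∃[o]m+o≡n lo
    ... | r , refl with rank-surjective r (+-cancelˡ-≤ (3 * k + 4) _ _ (≤-trans hi (≤-reflexive (sym max-rank))))
    ...   | v , refl = v , Tr-rank v

  Dob-order : order (Dob k) ≡ 2 * k + 5
  Dob-order = begin
    6 + length (As ++ Bs)        ≡⟨ cong (6 +_) (length-++ As) ⟩
    6 + (length As + length Bs)  ≡⟨ cong (6 +_) (cong₂ _+_ (family A) (family B)) ⟩
    6 + (k + m)                  ≡⟨ identity m ⟩
    2 * k + 5                    ∎
    where
    open ≡-Reasoning

    As Bs : List V
    As = map A (allFin k)
    Bs = map B (allFin m)

    family : ∀ {n} (g : Fin n → V) → length (map g (allFin n)) ≡ n
    family {n} g = trans (length-map g (allFin n)) (length-tabulate {n = n} id)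

    identity : ∀ m → 6 + (suc m + m) ≡ 2 * suc m + 5
    identity = solve-∀

  Dob-ITI : IntervalTransmissionIrregular (Dob k)
  Dob-ITI = Dob-TI , ℤ.+ (3 * k + 4) , ℤ.+ (5 * k + 8) , +≤+ lo≤hi , λ t → mk⇔ to from
    where
    lo≤hi : 3 * k + 4 ≤ 5 * k + 8
    lo≤hi = ≤-trans (m≤m+n (3 * k + 4) _) (≤-reflexive max-rank)

    to : ∀ {t} → (∃ λ v → ℤ.+ Tr (Dob k) v ≡ t) → ℤ.+ (3 * k + 4) ℤ.≤ t × t ℤ.≤ ℤ.+ (5 * k + 8)
    to (v , refl) with Equivalence.to (Tr-range _) (v , refl)
    ... | lo , hi = +≤+ lo , +≤+ hi

    from : ∀ {t} → ℤ.+ (3 * k + 4) ℤ.≤ t × t ℤ.≤ ℤ.+ (5 * k + 8) → ∃ λ v → ℤ.+ Tr (Dob k) v ≡ t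
    -- A nonnegative lower bound rules out negative `t`: matching on `+≤+` turns `t` into a natural
    -- number.
    from (+≤+ lo , +≤+ hi) with Equivalence.from (Tr-range _) (lo , hi)
    ... | v , eq = v , cong ℤ.+_ eq

theorem3 : ∀ (k : ℕ) → 1 ≤ k →
    IntervalTransmissionIrregular (Dob k)
    × order (Dob k) ≡ 2 * k + 5
    × TransmissionIrregular (Dob k)
    × (∀ (t : ℕ) → (∃ λ v → Tr (Dob k) v ≡ t) ⇔ (3 * k + 4 ≤ t × t ≤ 5 * k + 8))
theorem3 (suc m) _ = Dob-ITI {m} , Dob-order {m} , Dob-TI {m} , Tr-range {m}
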